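{- For all permutations $\pi$, it holds that $\mathsf{pw}(G_\pi)\le\mathsf{run}(\pi)$, where $G_\pi$ is the incidence graph of $\pi$, $\mathsf{pw}$ denotes pathwidth and $\mathsf{run}(\pi)$ is the number of alternating runs of $\pi$.
   Context: For $m\in\mathbb{N}$, $[m]=\{1,\dots,m\}$; an $m$-permutation is a bijection $\pi:[m]\to[m]$, viewed as the sequence $\pi(1),\dots,\pi(m)$. Alternating runs: a valley of $\pi$ is an element $\pi(i)$ smaller than both of its neighbours, a peak is an element larger than both of its neighbours; for the first and last element only the existing neighbour is compared. Valleys and peaks are the local extrema; the first and last elements of $\pi$ are always local extrema. The first alternating run consists of the elements from the first element up to and including the second local extremum; the second run starts with the following element and ends with the third local extremum, and so on. Thus every element lies in exactly one run, and $\mathsf{run}(\pi)$, the number of alternating runs, satisfies: $\mathsf{run}(\pi)+1$ is the number of local extrema (so it is $0$ if $m=1$). Example: $53142$ has the three runs $531\,|\,4\,|\,2$. Incidence graph: for an $m$-permutation $\pi$, $G_\pi=(V,E)$ has vertex set $V=[m]$ (positions in $\pi$) and edge set $E=E_1\cup E_2$ with $E_1=\{\{i,i+1\}\mid i\in[m-1]\}$ and $E_2=\{\{i,j\}\mid \pi(i)-\pi(j)=1\}$. Pathwidth: a path decomposition of a simple graph $G=(V,E)$ is a sequence of subsets $S_i\subseteq V$ such that (1) every vertex appears in at least one $S_i$; (2) every edge is a subset of at least one $S_i$; (3) for $h<i<j$, every vertex contained in both $S_h$ and $S_j$ is contained in $S_i$. Its width is $\max_i|S_i|-1$, and $\mathsf{pw}(G)$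 is the minimum width of any path decomposition of $G$. -}

module Defs where

open import Data.Fin.Base as Fin using (Fin; zero; suc; toℕ)
open import Data.Fin.Permutation using (Permutation′; _⟨$⟩ʳ_)
import Data.Fin.Properties as Fin
open import Data.Fin.Subset using (Subset; _∈_; ∣_∣; ⊤)
open import Data.Fin.Subset.Properties using (_∈?_; anySubset?; ∈⊤)
open import Data.List.Base as List using (List; []; _∷_; _∷ʳ_; length; filter; tabulate)
open import Data.List.Properties using (length-tabulate; filter-accept)
import Data.List.Membership.Propositional as List
open import Data.List.Membership.Propositional.Properties using (∈-tabulate⁺)
open import Data.List.Relation.Binary.Permutation.Propositional using (↭-sym)
open import Data.List.Relation.Binary.Permutation.Propositional.Properties using (↭-length; ∈-resp-↭)
import Data.List.Relation.Unary.Any as Any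
open import Data.List.Relation.Unary.Any.Properties using (lookup-index)
open import Data.List.Relation.Unary.Sorted.TotalOrder.Properties using (lookup-mono-≤)
open import Data.List.Sort using (sort; sort-↭; sort-↗)
open import Data.Nat.Base using (ℕ; zero; suc; _+_; _∸_; _⊔_; _≤_; z≤n; s≤s)
import Data.Nat.Properties as ℕ
open import Data.Product.Base using (∃; _×_; _,_; proj₁; proj₂)
open import Data.Sum.Base as Sum using (_⊎_; inj₁; inj₂)
open import Data.Vec.Base as Vec using (Vec; []; _∷_)
open import Data.Vec.Properties using (lookup∘tabulate)
open import Data.Vec.Functional using (Vector; foldr)
open import Function.Base using (_∘_)
open import Function.Bundles using (Injection)
open import Function.Properties.Inverse using (↔⇒↣)
open import Level using (0ℓ)
open import Relation.Binary.Core using (Rel)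
import Relation.Binary.Definitions as Binary
open import Relation.Binary.PropositionalEquality using (_≡_; refl; sym; trans; cong; subst)
open import Relation.Nullary using (¬_; Dec; yes; no; contradiction)
open import Relation.Nullary.Decidable using (map′; _×-dec_; _⊎-dec_; _→-dec_)
open import Relation.Unary using (Pred; Decidable)

record SimpleGraph (n : ℕ) : Set₁ where
  infix 4 _~_ _~?_
  field
    _~_    : Rel (Fin n) 0ℓ
    _~?_   : Binary.Decidable _~_
    ~-sym  : Binary.Symmetric _~_
    ~-irr  : Binary.Irreflexive _≡_ _~_

module _ {n : ℕ} (G : SimpleGraph n) where
  open SimpleGraph G

  record IsPathDecomposition {l : ℕ} (bag : Vector (Subset n) l) : Set where
    field
      vertex-covered : ∀ v → ∃ λ i → v ∈ bag i
      edge-covered   : ∀ {u v} → u ~ v → ∃ λ i → u ∈ bag i × v ∈ bag i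
      interpolating  : ∀ {h i j} → h Fin.< i → i Fin.< j →
                       ∀ {v} → v ∈ bag h → v ∈ bag j → v ∈ bag i

  record PathDecomposition : Set where
    field
      len                 : ℕ
      bag                 : Vector (Subset n) len
      isPathDecomposition : IsPathDecomposition bag

    open IsPathDecomposition isPathDecomposition public

    -- For n ≥ 1 some bag is nonempty, so the truncated subtraction is exact.
    -- For n = 0 it gives width 0 instead of -1.
    width : ℕ
    width = foldr _⊔_ 0 (∣_∣ ∘ bag) ∸ 1

  open PathDecomposition using (len; bag; width; isPathDecomposition)

  IsPathwidth : ℕ → Set
  IsPathwidth k = (∃ λ (D : PathDecomposition) → width D ≡ k) ×
                  (∀ (D : PathDecomposition) → k ≤ width D)

-- The minimum defining the pathwidth exists.  Discarding all bags but the
-- first one containing each vertex turns any path decomposition into one with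
-- (counting repetitions) exactly n bags and no larger width, so "width at most
-- k" is decided by a finite search.

max-upper : ∀ {l} (f : Vector ℕ l) i → f i ≤ foldr _⊔_ 0 f
max-upper f zero    = ℕ.m≤m⊔n _ _
max-upper f (suc i) = ℕ.≤-trans (max-upper (f ∘ suc) i) (ℕ.m≤n⊔m _ _)

max-least : ∀ {l} (f : Vector ℕ l) {k} → (∀ i → f i ≤ k) → foldr _⊔_ 0 f ≤ k
max-least {zero}  f f≤ = z≤n
max-least {suc l} f f≤ = ℕ.⊔-lub (f≤ zero) (max-least (f ∘ suc) (f≤ ∘ suc))

first : ∀ {l} {P : Pred (Fin l) 0ℓ} → Decidable P → ∃ P →
        ∃ λ i → P i × (∀ {j} → P j → i Fin.≤ j)
first {suc l} P? (i , pi) with P? zero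
... | yes p0 = zero , p0 , λ _ → z≤n
first {suc l} P? (zero  , pi) | no ¬p0 = contradiction pi ¬p0
first {suc l} {P} P? (suc i , pi) | no ¬p0
  with i₀ , p , least ← first (P? ∘ suc) (i , pi)
  = suc i₀ , p , least′
  where
  least′ : ∀ {j} → P j → suc i₀ Fin.≤ j
  least′ {zero}  pj = contradiction pj ¬p0
  least′ {suc j} pj = s≤s (least pj)

anyVec? : ∀ {n l} {P : Pred (Vec (Subset n) l) 0ℓ} → Decidable P → Dec (∃ P)
anyVec? {l = zero}  P? = map′ ([] ,_) (λ { ([] , p) → p }) (P? [])
anyVec? {l = suc l} P? =
  map′ (λ { (s , ss , p) → s ∷ ss , p }) (λ { (s ∷ ss , p) → s , ss , p })
       (anySubset? λ s → anyVec? λ ss → P? (s ∷ ss))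

least-ℕ : {P : Pred ℕ 0ℓ} → Decidable P → ∀ {b} → P b →
          ∃ λ k → P k × (∀ {m} → P m → k ≤ m)
least-ℕ P? {b} pb with P? zero
... | yes p0 = zero , p0 , λ _ → z≤n
least-ℕ P? {zero}  pb | no ¬p0 = contradiction pb ¬p0
least-ℕ {P} P? {suc b} pb | no ¬p0
  with k , pk , least ← least-ℕ (P? ∘ suc) pb
  = suc k , pk , least′
  where
  least′ : ∀ {m} → P m → suc k ≤ m
  least′ {zero}  pm = contradiction pm ¬p0
  least′ {suc m} pm = s≤s (least pm)

module _ {n : ℕ} (G : SimpleGraph n) where
  open SimpleGraph G
  open PathDecomposition using (len; bag; width; isPathDecomposition)

  isPathDecomposition? : ∀ {l} (bag : Vector (Subset n) l) → Dec (IsPathDecomposition G bag)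
  isPathDecomposition? bag =
    map′ (λ { (vc , ec , ip) → record
               { vertex-covered = vc
               ; edge-covered   = ec _ _
               ; interpolating  = λ h<i i<j → ip _ _ _ h<i i<j _ } })
         (λ D → let open IsPathDecomposition D in
                vertex-covered , (λ _ _ → edge-covered) ,
                λ _ _ _ h<i i<j _ → interpolating h<i i<j)
         ( Fin.all? (λ v → Fin.any? λ i → v ∈? bag i)
     ×-dec Fin.all? (λ u → Fin.all? λ v → (u ~? v) →-dec
             Fin.any? λ i → (u ∈? bag i) ×-dec (v ∈? bag i))
     ×-dec Fin.all? (λ h → Fin.all? λ i → Fin.all? λ j →
             (h Fin.<? i) →-dec ((i Fin.<? j) →-dec
             Fin.all? λ v → (v ∈? bag h) →-dec ((v ∈? bag j) →-dec (v ∈? bag i)))))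

  isPathDecomposition-resp : ∀ {l} {bag bag′ : Vector (Subset n) l} →
    (∀ i → bag i ≡ bag′ i) → IsPathDecomposition G bag → IsPathDecomposition G bag′
  isPathDecomposition-resp {bag = bag} {bag′} eq D = record
    { vertex-covered = λ v → let i , p = vertex-covered v in i , to p
    ; edge-covered   = λ e → let i , p , q = edge-covered e in i , to p , to q
    ; interpolating  = λ h<i i<j p q → to (interpolating h<i i<j (from p) (from q))
    }
    where
    open IsPathDecomposition D
    to : ∀ {i v} → v ∈ bag i → v ∈ bag′ i
    to {i} {v} = subst (v ∈_) (eq i)
    from : ∀ {i v} → v ∈ bag′ i → v ∈ bag i
    from {i} {v} = subst (v ∈_) (sym (eq i))

  module Shorten (D : PathDecomposition G) where
    private
      module D = PathDecomposition D
      O = Fin.≤-decTotalOrder D.len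

      first-bag : ∀ v → ∃ λ i → v ∈ D.bag i × (∀ {j} → v ∈ D.bag j → i Fin.≤ j)
      first-bag v = first (λ i → v ∈? D.bag i) (D.vertex-covered v)

      f : Fin n → Fin D.len
      f v = proj₁ (first-bag v)

      f∈ : ∀ v → v ∈ D.bag (f v)
      f∈ v = proj₁ (proj₂ (first-bag v))

      f≤ : ∀ {v j} → v ∈ D.bag j → f v Fin.≤ j
      f≤ {v} = proj₂ (proj₂ (first-bag v))

      between : ∀ {h i j v} → h Fin.≤ i → i Fin.≤ j →
                v ∈ D.bag h → v ∈ D.bag j → v ∈ D.bag i
      between {h} {i} {j} {v} h≤i i≤j p q with ℕ.m≤n⇒m<n∨m≡n h≤i | ℕ.m≤n⇒m<n∨m≡n i≤j
      ... | inj₂ h≡i | _        = subst (λ x → v ∈ D.bag x) (Fin.toℕ-injective h≡i) p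
      ... | inj₁ _   | inj₂ i≡j = subst (λ x → v ∈ D.bag x) (sym (Fin.toℕ-injective i≡j)) q
      ... | inj₁ h<i | inj₁ i<j = D.interpolating h<i i<j p q

      ixs : List (Fin D.len)
      ixs = sort O (tabulate f)

      g : Fin (length ixs) → Fin D.len
      g = List.lookup ixs

      g-mono : ∀ {i j} → i Fin.≤ j → g i Fin.≤ g j
      g-mono = lookup-mono-≤ (Fin.≤-totalOrder D.len) (sort-↗ O (tabulate f))

      f⊆g : ∀ v → ∃ λ i → f v ≡ g i
      f⊆g v = Any.index f∈ixs , lookup-index f∈ixs
        where
        f∈ixs : f v List.∈ ixs
        f∈ixs = ∈-resp-↭ (↭-sym (sort-↭ O (tabulate f))) (∈-tabulate⁺ v)

      hit : ∀ {v} {w} → v ∈ D.bag (f w) → ∃ λ i → f w ≡ g i × v ∈ D.bag (g i)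
      hit {v} {w} p with i , eq ← f⊆g w = i , eq , subst (λ x → v ∈ D.bag x) eq p

    short : PathDecomposition G
    short = record
      { len = length ixs
      ; bag = D.bag ∘ g
      ; isPathDecomposition = record
        { vertex-covered = λ v → let i , _ , p = hit (f∈ v) in i , p
        ; edge-covered   = edge
        ; interpolating  = λ h<i i<j p q →
            between (g-mono (ℕ.<⇒≤ h<i)) (g-mono (ℕ.<⇒≤ i<j)) p q
        }
      }
      where
      edge : ∀ {u v} → u ~ v → ∃ λ i → u ∈ D.bag (g i) × v ∈ D.bag (g i)
      edge {u} {v} e with j , p , q ← D.edge-covered e | ℕ.≤-total (toℕ (f u)) (toℕ (f v))
      ... | inj₁ fu≤fv with i , eq , r ← hit (f∈ v)
          = i , subst (λ x → u ∈ D.bag x) eq (between fu≤fv (f≤ q) (f∈ u) p) , r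
      ... | inj₂ fv≤fu with i , eq , r ← hit (f∈ u)
          = i , r , subst (λ x → v ∈ D.bag x) eq (between fv≤fu (f≤ p) (f∈ v) q)

    short-len : len short ≡ n
    short-len = trans (↭-length (sort-↭ O (tabulate f))) (length-tabulate f)

    short-width : width short ≤ width D
    short-width = ℕ.∸-monoˡ-≤ 1 (max-least (∣_∣ ∘ D.bag ∘ g) (λ i → max-upper (∣_∣ ∘ D.bag) (g i)))

  HasWidth≤ : ℕ → Set
  HasWidth≤ k = ∃ λ (D : PathDecomposition G) → width D ≤ k

  private
    vec-decomposition : ∀ {k} (D : PathDecomposition G) → len D ≡ n → width D ≤ k →
      ∃ λ (bags : Vec (Subset n) n) → IsPathDecomposition G (Vec.lookup bags) ×
                                      foldr _⊔_ 0 (∣_∣ ∘ Vec.lookup bags) ∸ 1 ≤ k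
    vec-decomposition D refl w≤k = Vec.tabulate (bag D) ,
      isPathDecomposition-resp (λ i → sym (lookup∘tabulate (bag D) i)) (isPathDecomposition D) ,
      ℕ.≤-trans (ℕ.∸-monoˡ-≤ 1 (max-least (∣_∣ ∘ Vec.lookup (Vec.tabulate (bag D))) λ i →
                  ℕ.≤-trans (ℕ.≤-reflexive (cong ∣_∣ (lookup∘tabulate (bag D) i)))
                            (max-upper (∣_∣ ∘ bag D) i)))
                w≤k

  hasWidth≤? : Decidable HasWidth≤
  hasWidth≤? k = map′
    (λ { (bags , D , w≤k) → record { isPathDecomposition = D } , w≤k })
    (λ { (D , w≤k) → let open Shorten D in
                     vec-decomposition short short-len (ℕ.≤-trans short-width w≤k) })
    (anyVec? λ bags → isPathDecomposition? (Vec.lookup bags) ×-dec (_ ℕ.≤? k))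

  trivial : PathDecomposition G
  trivial = record
    { len = 1
    ; bag = λ _ → ⊤
    ; isPathDecomposition = record
      { vertex-covered = λ _ → zero , ∈⊤
      ; edge-covered   = λ _ → zero , ∈⊤ , ∈⊤
      ; interpolating  = λ _ _ _ _ → ∈⊤
      }
    }

  pathwidth : ∃ (IsPathwidth G)
  pathwidth with least-ℕ hasWidth≤? (trivial , ℕ.≤-refl)
  ... | k , (D , w≤k) , least =
    k , (D , ℕ.≤-antisym w≤k (least (D , ℕ.≤-refl))) , λ D′ → least (D′ , ℕ.≤-refl)

  pw : ℕ
  pw = proj₁ pathwidth

  pw-isPathwidth : IsPathwidth G pw
  pw-isPathwidth = proj₂ pathwidth

Consecutive : ∀ {m} → Rel (Fin m) 0ℓ
Consecutive i j = toℕ i ≡ suc (toℕ j) ⊎ toℕ j ≡ suc (toℕ i)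

consecutive? : ∀ {m} → Binary.Decidable (Consecutive {m})
consecutive? i j = (toℕ i ℕ.≟ suc (toℕ j)) ⊎-dec (toℕ j ℕ.≟ suc (toℕ i))

consecutive-irr : ∀ {m} {i : Fin m} → ¬ Consecutive i i
consecutive-irr (inj₁ eq) = ℕ.1+n≢n (sym eq)
consecutive-irr (inj₂ eq) = ℕ.1+n≢n (sym eq)

-- Positions and values are numbered from 0 instead of 1.
incidenceGraph : ∀ {m} → Permutation′ m → SimpleGraph m
incidenceGraph π = record
  { _~_   = λ i j → Consecutive i j ⊎ Consecutive (π ⟨$⟩ʳ i) (π ⟨$⟩ʳ j)
  ; _~?_  = λ i j → consecutive? i j ⊎-dec consecutive? (π ⟨$⟩ʳ i) (π ⟨$⟩ʳ j)
  ; ~-sym = Sum.map Sum.swap Sum.swap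
  ; ~-irr = λ { refl → Sum.[ consecutive-irr , consecutive-irr ] }
  }

-- cut P? acc xs cuts acc ++ xs after every element of xs that satisfies P;
-- elements after the last cut are dropped.
cut : {A : Set} {P : Pred A 0ℓ} → Decidable P → List A → List A → List (List A)
cut P? acc []       = []
cut P? acc (x ∷ xs) with P? x
... | yes _ = (acc ∷ʳ x) ∷ cut P? [] xs
... | no  _ = cut P? (acc ∷ʳ x) xs

module _ {m : ℕ} (π : Permutation′ m) where

  Valley Peak LocalExtremum : Pred (Fin m) 0ℓ
  Valley i        = ∀ j → Consecutive i j → π ⟨$⟩ʳ i Fin.< π ⟨$⟩ʳ j
  Peak i          = ∀ j → Consecutive i j → π ⟨$⟩ʳ j Fin.< π ⟨$⟩ʳ i
  LocalExtremum i = Valley i ⊎ Peak i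

  localExtremum? : Decidable LocalExtremum
  localExtremum? i =
          Fin.all? (λ j → consecutive? i j →-dec (π ⟨$⟩ʳ i Fin.<? π ⟨$⟩ʳ j))
    ⊎-dec Fin.all? (λ j → consecutive? i j →-dec (π ⟨$⟩ʳ j Fin.<? π ⟨$⟩ʳ i))

-- Runs are given as lists of positions.  The first position is the first local
-- extremum and does not end a run; each later local extremum does.  The last
-- position is a local extremum, so nothing is dropped unless m = 1, where there
-- are no runs.
runs : ∀ {m} → Permutation′ m → List (List (Fin m))
runs {zero}  π = []
runs {suc m} π = cut (localExtremum? π) (zero ∷ []) (tabulate suc)

run : ∀ {m} → Permutation′ m → ℕ
run π = length (runs π)

length-cut : {A : Set} {P : Pred A 0ℓ} (P? : Decidable P) (acc xs : List A) →
             length (cut P? acc xs) ≡ length (filter P? xs)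
length-cut P? acc []       = refl
length-cut P? acc (x ∷ xs) with P? x
... | yes _ = cong suc (length-cut P? [] xs)
... | no  _ = length-cut P? (acc ∷ʳ x) xs

first-extremum : ∀ {m} (π : Permutation′ (suc m)) → LocalExtremum π zero
first-extremum {zero}  π = inj₁ λ { zero (inj₁ ()) ; zero (inj₂ ()) }
first-extremum {suc m} π with ℕ.<-cmp (toℕ (π ⟨$⟩ʳ zero)) (toℕ (π ⟨$⟩ʳ suc zero))
... | Binary.tri< π₀<π₁ _ _ = inj₁ λ { zero (inj₁ ()) ; zero (inj₂ ()) ; (suc zero) _ → π₀<π₁
                                     ; (suc (suc _)) (inj₁ ()) ; (suc (suc _)) (inj₂ ()) }
... | Binary.tri> _ _ π₁<π₀ = inj₂ λ { zero (inj₁ ()) ; zero (inj₂ ()) ; (suc zero) _ → π₁<π₀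
                                     ; (suc (suc _)) (inj₁ ()) ; (suc (suc _)) (inj₂ ()) }
... | Binary.tri≈ _ π₀≡π₁ _ with () ← Injection.injective (↔⇒↣ π) (Fin.toℕ-injective π₀≡π₁)

run+1≡#extrema : ∀ {m} (π : Permutation′ (suc m)) →
                 run π + 1 ≡ length (filter (localExtremum? π) (List.allFin (suc m)))
run+1≡#extrema π = trans (ℕ.+-comm (run π) 1)
  (trans (cong suc (length-cut (localExtremum? π) (zero ∷ []) (tabulate suc)))
         (sym (cong length (filter-accept (localExtremum? π) (first-extremum π)))))

{-# OPTIONS --safe #-}

-- Sweep the values from small to large.  The bag of the value v consists of the
-- position of v and of the boundary: the positions of smaller values that have
-- a neighbour of value at least v.  To bound the boundary by the number of runs,
-- send each boundary position p to an edge of the path of positions at p whose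
-- other end has value at least v, or to any edge at p if there is none (then
-- v - 1 is the value at p).  Two boundary positions p < p′ whose edges are not
-- separated by a local extremum would lie on a monotone stretch containing both
-- edges, which is impossible.  As the last position is a local extremum, the
-- number of local extrema up to an edge, not counting the first position, is
-- therefore an injection from the boundary into the naturals below run π.
module Submission where

open import Defs
open import Data.Bool.Base using (true)
open import Data.Nat using (ℕ; _≤_)
open import Data.Fin.Permutation using (Permutation′)

open import Data.Fin.Base as Fin using (Fin; zero; suc; toℕ; fromℕ; inject₁)
open import Data.Fin.Induction using (<-weakInduction-startingFrom)
open import Data.Fin.Permutation using (_⟨$⟩ʳ_; _⟨$⟩ˡ_; inverseˡ; inverseʳ)
import Data.Fin.Properties as Fin
open import Data.Fin.Subset using (Subset; _∈_; ∣_∣; _∪_; ⁅_⁆; inside; outside)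
open import Data.Fin.Subset.Properties
  using (x∈p∪q⁺; x∈p∪q⁻; x∈⁅x⁆; x∈⁅y⁆⇒x≡y; ∪-identityʳ)
open import Data.List.Base using ([]; _∷_; length; filter; tabulate; take)
open import Data.List.Properties using (length-tabulate; take-all)
open import Data.Nat.Base using (zero; suc; _+_; _<_; z≤n; s≤s; s≤s⁻¹)
import Data.Nat.Properties as ℕ
open import Data.Product.Base using (∃; _×_; _,_; proj₁; proj₂)
open import Data.Sum.Base using (_⊎_; inj₁; inj₂)
import Data.Vec.Base as Vec
open import Data.Vec.Base using ([]; _∷_; here; there)
open import Data.Vec.Properties using (lookup∘tabulate; lookup⇒[]=; []=⇒lookup)
open import Function.Base using (_∘_)
open import Function.Bundles using (Injection)
open import Function.Properties.Inverse using (↔⇒↣)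
open import Level using (0ℓ)
open import Relation.Binary.Core using (Rel)
open import Relation.Binary.Definitions using (Reflexive; Transitive; tri<; tri≈; tri>)
open import Relation.Binary.PropositionalEquality
  using (_≡_; _≢_; refl; sym; trans; cong; subst)
open import Relation.Nullary using (¬_; does; yes; no; contradiction)
open import Relation.Nullary.Decidable using (dec-true; _×-dec_)
open import Relation.Unary using (Pred; Decidable)

-- Subsets cut out by decidable predicates, and counting

module _ {n : ℕ} {P : Pred (Fin n) 0ℓ} (P? : Decidable P) where

  comprehension : Subset n
  comprehension = Vec.tabulate (does ∘ P?)

  ∈-comprehension⁺ : ∀ {x} → P x → x ∈ comprehension
  ∈-comprehension⁺ {x} px =
    lookup⇒[]= x _ (trans (lookup∘tabulate (does ∘ P?) x) (dec-true (P? x) px))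

  ∈-comprehension⁻ : ∀ {x} → x ∈ comprehension → P x
  ∈-comprehension⁻ {x} x∈ = witness (trans (sym (lookup∘tabulate (does ∘ P?) x)) ([]=⇒lookup x∈))
    where
    witness : does (P? x) ≡ true → P x
    witness eq with yes px ← P? x = px

∣p∪⁅x⁆∣≤1+∣p∣ : ∀ {n} (p : Subset n) x → ∣ p ∪ ⁅ x ⁆ ∣ ≤ suc ∣ p ∣
∣p∪⁅x⁆∣≤1+∣p∣ (inside  ∷ p) zero    rewrite ∪-identityʳ p = ℕ.n≤1+n _
∣p∪⁅x⁆∣≤1+∣p∣ (outside ∷ p) zero    rewrite ∪-identityʳ p = ℕ.≤-refl
∣p∪⁅x⁆∣≤1+∣p∣ (inside  ∷ p) (suc x) = s≤s (∣p∪⁅x⁆∣≤1+∣p∣ p x)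
∣p∪⁅x⁆∣≤1+∣p∣ (outside ∷ p) (suc x) = ∣p∪⁅x⁆∣≤1+∣p∣ p x

-- `f` takes the membership proof because the edge chosen at a boundary position is extracted from
-- that proof.
strictMono⇒∣p∣≤ : ∀ {n k} (p : Subset n) (f : ∀ {x} → x ∈ p → ℕ) →
                  (∀ {x} (x∈p : x ∈ p) → f x∈p < k) →
                  (∀ {x y} (x∈p : x ∈ p) (y∈p : y ∈ p) → x Fin.< y → f x∈p < f y∈p) →
                  ∣ p ∣ ≤ k
strictMono⇒∣p∣≤ {k = k} p f f<k mono = go p z≤n f (λ _ → z≤n) f<k mono
  where
  -- `a` bounds the values still to come from below; each element found raises it to `suc (f here)`.
  go : ∀ {n a} (p : Subset n) → a ≤ k → (f : ∀ {x} → x ∈ p → ℕ) →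
       (∀ {x} (x∈p : x ∈ p) → a ≤ f x∈p) →
       (∀ {x} (x∈p : x ∈ p) → f x∈p < k) →
       (∀ {x y} (x∈p : x ∈ p) (y∈p : y ∈ p) → x Fin.< y → f x∈p < f y∈p) →
       a + ∣ p ∣ ≤ k
  go [] a≤k f a≤f f<k mono = subst (_≤ k) (sym (ℕ.+-identityʳ _)) a≤k
  go (outside ∷ p) a≤k f a≤f f<k mono =
    go p a≤k (f ∘ there) (a≤f ∘ there) (f<k ∘ there)
       (λ x∈p y∈p → mono (there x∈p) (there y∈p) ∘ s≤s)
  go {a = a} (inside ∷ p) a≤k f a≤f f<k mono =
    subst (_≤ k) (sym (ℕ.+-suc a ∣ p ∣))
      (ℕ.≤-trans (s≤s (ℕ.+-monoˡ-≤ ∣ p ∣ (a≤f here)))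
        (go p (f<k here) (f ∘ there) (λ x∈p → mono here (there x∈p) (s≤s z≤n)) (f<k ∘ there)
            (λ x∈p y∈p → mono (there x∈p) (there y∈p) ∘ s≤s)))

-- The entry `f e` is counted in the longer prefix but lies beyond the shorter one. This turns an
-- extremum between two edges into strict growth of the count.
length-filter-take-< : ∀ {A : Set} {P : Pred A 0ℓ} (P? : Decidable P) {n} (f : Fin n → A) {i j} e →
  P (f e) → i ≤ toℕ e → toℕ e < j →
  length (filter P? (take i (tabulate f))) < length (filter P? (take j (tabulate f)))
length-filter-take-< P? f {zero} {suc j} zero pe i≤e e<j with P? (f zero)
... | yes _ = s≤s z≤n
... | no ¬p = contradiction pe ¬p
length-filter-take-< P? f {zero} {suc j} (suc e) pe i≤e e<j with P? (f zero)
... | yes _ = s≤s z≤n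
... | no  _ = length-filter-take-< P? (f ∘ suc) {zero} e pe z≤n (s≤s⁻¹ e<j)
length-filter-take-< P? f {suc i} {suc j} (suc e) pe i≤e e<j with P? (f zero)
... | yes _ = s≤s (length-filter-take-< P? (f ∘ suc) e pe (s≤s⁻¹ i≤e) (s≤s⁻¹ e<j))
... | no  _ = length-filter-take-< P? (f ∘ suc) e pe (s≤s⁻¹ i≤e) (s≤s⁻¹ e<j)

-- The path decomposition swept out by increasing values

module Sweep {n : ℕ} (G : SimpleGraph n) (π : Permutation′ n) where
  open SimpleGraph G

  Boundary : Fin n → Pred (Fin n) 0ℓ
  Boundary v p = π ⟨$⟩ʳ p Fin.< v × ∃ λ q → p ~ q × v Fin.≤ π ⟨$⟩ʳ q

  boundary? : ∀ v → Decidable (Boundary v)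
  boundary? v p = (π ⟨$⟩ʳ p Fin.<? v) ×-dec Fin.any? λ q → (p ~? q) ×-dec (v Fin.≤? π ⟨$⟩ʳ q)

  boundary : Fin n → Subset n
  boundary v = comprehension (boundary? v)

  bag : Fin n → Subset n
  bag v = boundary v ∪ ⁅ π ⟨$⟩ˡ v ⁆

  ∈-bag⁺ : ∀ {v p} → Boundary v p ⊎ π ⟨$⟩ʳ p ≡ v → p ∈ bag v
  ∈-bag⁺ {v} (inj₁ b)    = x∈p∪q⁺ (inj₁ (∈-comprehension⁺ (boundary? v) b))
  ∈-bag⁺ {p = p} (inj₂ refl) =
    x∈p∪q⁺ (inj₂ (subst (λ x → p ∈ ⁅ x ⁆) (sym (inverseˡ π)) (x∈⁅x⁆ p)))

  ∈-bag⁻ : ∀ {v p} → p ∈ bag v → Boundary v p ⊎ π ⟨$⟩ʳ p ≡ v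
  ∈-bag⁻ {v} p∈ with x∈p∪q⁻ (boundary v) ⁅ π ⟨$⟩ˡ v ⁆ p∈
  ... | inj₁ p∈b = inj₁ (∈-comprehension⁻ (boundary? v) p∈b)
  ... | inj₂ p∈s = inj₂ (trans (cong (π ⟨$⟩ʳ_) (x∈⁅y⁆⇒x≡y _ p∈s)) (inverseʳ π))

  bag-edge : ∀ {u v} → u ~ v → π ⟨$⟩ʳ u Fin.≤ π ⟨$⟩ʳ v → u ∈ bag (π ⟨$⟩ʳ v)
  bag-edge {u} {v} e πu≤πv with ℕ.m≤n⇒m<n∨m≡n πu≤πv
  ... | inj₁ πu<πv = ∈-bag⁺ (inj₁ (πu<πv , v , e , ℕ.≤-refl))
  ... | inj₂ πu≡πv = ∈-bag⁺ (inj₂ (Fin.toℕ-injective πu≡πv))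

  bag-value≤ : ∀ {v p} → p ∈ bag v → π ⟨$⟩ʳ p Fin.≤ v
  bag-value≤ p∈ with ∈-bag⁻ p∈
  ... | inj₁ (πp<v , _) = ℕ.<⇒≤ πp<v
  ... | inj₂ refl       = ℕ.≤-refl

  -- Membership in the earlier bag keeps the value of `p` below `i`; membership in the later one
  -- supplies a neighbour of value at least `j`, hence at least `i`.
  bag-interpolating : ∀ {h i j} → h Fin.< i → i Fin.< j →
                      ∀ {p} → p ∈ bag h → p ∈ bag j → p ∈ bag i
  bag-interpolating h<i i<j {p} p∈h p∈j with ∈-bag⁻ p∈j
  ... | inj₁ (_ , q , e , j≤πq) =
    ∈-bag⁺ (inj₁ (ℕ.≤-<-trans (bag-value≤ p∈h) h<i , q , e , ℕ.≤-trans (ℕ.<⇒≤ i<j) j≤πq))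
  ... | inj₂ refl = contradiction (ℕ.<-trans h<i i<j) (ℕ.≤⇒≯ (bag-value≤ p∈h))

  sweep : PathDecomposition G
  sweep = record
    { len = n
    ; bag = bag
    ; isPathDecomposition = record
      { vertex-covered = λ p → π ⟨$⟩ʳ p , ∈-bag⁺ (inj₂ refl)
      ; edge-covered   = edge
      ; interpolating  = bag-interpolating
      }
    }
    where
    edge : ∀ {u v} → u ~ v → ∃ λ i → u ∈ bag i × v ∈ bag i
    edge {u} {v} e with Fin.≤-total (π ⟨$⟩ʳ u) (π ⟨$⟩ʳ v)
    ... | inj₁ πu≤πv = π ⟨$⟩ʳ v , bag-edge e πu≤πv , ∈-bag⁺ (inj₂ refl)
    ... | inj₂ πv≤πu = π ⟨$⟩ʳ u , ∈-bag⁺ (inj₂ refl) , bag-edge (~-sym e) πv≤πu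

  -- The one position that a bag adds to the boundary is offset by the 1 subtracted in the width.
  pw≤ : ∀ {k} → (∀ v → ∣ boundary v ∣ ≤ k) → pw G ≤ k
  pw≤ boundary≤k = ℕ.≤-trans (proj₂ (pw-isPathwidth G) sweep)
    (ℕ.∸-monoˡ-≤ 1 (max-least (∣_∣ ∘ bag) λ v →
      ℕ.≤-trans (∣p∪⁅x⁆∣≤1+∣p∣ (boundary v) (π ⟨$⟩ˡ v)) (s≤s (boundary≤k v))))

-- Monotone stretches between extrema

module Stretch {n : ℕ} {R : Rel (Fin (suc (suc n))) 0ℓ} (R-refl : Reflexive R) (R-trans : Transitive R)
  {E : Pred (Fin (suc n)) 0ℓ}
  (R-step : ∀ j → ¬ E (inject₁ j) →
            R (inject₁ (inject₁ j)) (suc (inject₁ j)) → R (suc (inject₁ j)) (suc (suc j)))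
  {a b : Fin (suc n)} (¬E : ∀ {e} → a Fin.≤ e → e Fin.< b → ¬ E e)
  (Ra : R (inject₁ a) (suc a))
  where

  -- `R` will compare values by ≤ or by ≥, so that one induction serves ascents and descents. `E e`
  -- concerns the position `suc e`, where the edge `e` meets the next one.
  stretch-edge : ∀ {e} → a Fin.≤ e → e Fin.≤ b → R (inject₁ e) (suc e)
  stretch-edge a≤e = proj₂ (<-weakInduction-startingFrom
    -- The motive carries `a Fin.≤ e` along, since `¬E` asks for it at every step.
    (λ e → a Fin.≤ e × (e Fin.≤ b → R (inject₁ e) (suc e)))
    (ℕ.≤-refl , λ _ → Ra)
    (λ j (a≤j , r) →
      ℕ.≤-trans a≤j (ℕ.≤-trans (ℕ.≤-reflexive (Fin.toℕ-inject₁ j)) (ℕ.n≤1+n _)) ,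
      λ 1+j≤b → let j<b = subst (_< toℕ b) (sym (Fin.toℕ-inject₁ j)) 1+j≤b in
        R-step j (¬E a≤j j<b) (r (ℕ.<⇒≤ j<b)))
    a≤e)

  stretch : ∀ {x y} → toℕ a ≤ toℕ x → x Fin.≤ y → y Fin.≤ suc b → R x y
  stretch {x} a≤x x≤y = proj₂ (<-weakInduction-startingFrom
    (λ y → x Fin.≤ y × (y Fin.≤ suc b → R x y))
    (ℕ.≤-refl , λ _ → R-refl)
    (λ j (x≤j , r) → let x≤j′ = subst (toℕ x ≤_) (Fin.toℕ-inject₁ j) x≤j in
      ℕ.m≤n⇒m≤1+n x≤j′ ,
      λ 1+j≤1+b → let j≤b = s≤s⁻¹ 1+j≤1+b in
        R-trans (r (ℕ.≤-trans (ℕ.≤-reflexive (Fin.toℕ-inject₁ j)) (ℕ.m≤n⇒m≤1+n j≤b)))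
                (stretch-edge (ℕ.≤-trans a≤x x≤j′) j≤b))
    x≤y)

-- Boundary positions and alternating runs

module _ {n : ℕ} (π : Permutation′ (suc (suc n))) where
  open Sweep (incidenceGraph π) π

  val : Fin (suc (suc n)) → Fin (suc (suc n))
  val = π ⟨$⟩ʳ_

  val-injective : ∀ {i j} → toℕ (val i) ≡ toℕ (val j) → i ≡ j
  val-injective eq = Injection.injective (↔⇒↣ π) (Fin.toℕ-injective eq)

  -- Indexing by the edge that ends at the position leaves out the first position, which ends no
  -- run.
  Extremum : Pred (Fin (suc n)) 0ℓ
  Extremum e = LocalExtremum π (suc e)

  val-distinct : ∀ {i j} → i Fin.< j → toℕ (val i) ≢ toℕ (val j)
  val-distinct i<j eq = ℕ.<⇒≢ i<j (cong toℕ (val-injective eq))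

  ends-distinct : ∀ e → toℕ (val (inject₁ e)) ≢ toℕ (val (suc e))
  ends-distinct e = val-distinct (Fin.≤̄⇒inject₁< ℕ.≤-refl)

  last-neighbours : {Q : Pred (Fin (suc (suc n))) 0ℓ} → Q (inject₁ (fromℕ n)) →
                    ∀ i → Consecutive (suc (fromℕ n)) i → Q i
  last-neighbours {Q} q i (inj₁ eq) =
    subst Q (Fin.toℕ-injective (trans (Fin.toℕ-inject₁ (fromℕ n)) (ℕ.suc-injective eq))) q
  -- A right neighbour would have index n + 2, which is out of range.
  last-neighbours q i (inj₂ eq) = contradiction (Fin.toℕ<n i)
    (ℕ.≤⇒≯ (ℕ.≤-reflexive (trans (cong (2 +_) (sym (Fin.toℕ-fromℕ n))) (sym eq))))

  last-extremum : Extremum (fromℕ n)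
  last-extremum with ℕ.<-cmp (toℕ (val (inject₁ (fromℕ n)))) (toℕ (val (suc (fromℕ n))))
  ... | tri< up _ _ = inj₂ (last-neighbours up)
  ... | tri≈ _ flat _ = contradiction flat (ends-distinct (fromℕ n))
  ... | tri> _ _ down = inj₁ (last-neighbours down)

  inner-neighbours : ∀ {Q : Pred (Fin (suc (suc n))) 0ℓ} j →
    Q (inject₁ (inject₁ j)) → Q (suc (suc j)) → ∀ i → Consecutive (suc (inject₁ j)) i → Q i
  inner-neighbours {Q} j q q′ i (inj₁ eq) =
    subst Q (Fin.toℕ-injective (trans (Fin.toℕ-inject₁ (inject₁ j)) (ℕ.suc-injective eq))) q
  inner-neighbours {Q} j q q′ i (inj₂ eq) =
    subst Q (Fin.toℕ-injective (trans (cong (2 +_) (sym (Fin.toℕ-inject₁ j))) (sym eq))) q′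

  -- A fall after the rise would make the middle position a peak. The inequalities are weak because
  -- `Stretch` needs a reflexive relation; injectivity makes them strict where required.
  ascent-continues : ∀ j → ¬ Extremum (inject₁ j) →
    val (inject₁ (inject₁ j)) Fin.≤ val (suc (inject₁ j)) → val (suc (inject₁ j)) Fin.≤ val (suc (suc j))
  ascent-continues j ¬ext up = ℕ.≮⇒≥ λ down → ¬ext (inj₂ (inner-neighbours j
    (ℕ.≤∧≢⇒< up (ends-distinct (inject₁ j))) down))

  descent-continues : ∀ j → ¬ Extremum (inject₁ j) →
    val (suc (inject₁ j)) Fin.≤ val (inject₁ (inject₁ j)) → val (suc (suc j)) Fin.≤ val (suc (inject₁ j))
  descent-continues j ¬ext down = ℕ.≮⇒≥ λ up → ¬ext (inj₁ (inner-neighbours j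
    (ℕ.≤∧≢⇒< down (ends-distinct (inject₁ j) ∘ sym)) up))

  -- d stands for the edge between the positions inject₁ d and suc d.
  record Slot (v p : Fin (suc (suc n))) (d : Fin (suc n)) : Set where
    field
      lower      : toℕ d ≤ toℕ p
      upper      : p Fin.≤ suc d
      ascending  : val (inject₁ d) Fin.≤ val (suc d) →
                   v Fin.≤ val (suc d) ⊎ toℕ v ≡ suc (toℕ (val p))
      descending : val (suc d) Fin.≤ val (inject₁ d) →
                   v Fin.≤ val (inject₁ d) ⊎ toℕ v ≡ suc (toℕ (val p))

  slot-right : ∀ {v d} → val (inject₁ d) Fin.< v → v Fin.≤ val (suc d) → Slot v (inject₁ d) d
  slot-right {d = d} <v v≤ = record
    { lower      = ℕ.≤-reflexive (sym (Fin.toℕ-inject₁ d))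
    ; upper      = ℕ.m≤n⇒m≤1+n (ℕ.≤-reflexive (Fin.toℕ-inject₁ d))
    ; ascending  = λ _ → inj₁ v≤
    ; descending = λ down → contradiction (ℕ.<-≤-trans <v v≤) (ℕ.≤⇒≯ down)
    }

  slot-left : ∀ {v d} → val (suc d) Fin.< v → v Fin.≤ val (inject₁ d) → Slot v (suc d) d
  slot-left <v v≤ = record
    { lower      = ℕ.n≤1+n _
    ; upper      = ℕ.≤-refl
    ; ascending  = λ up → contradiction (ℕ.<-≤-trans <v v≤) (ℕ.≤⇒≯ up)
    ; descending = λ _ → inj₁ v≤
    }

  -- Any edge at `p` will do: the one to its left, or the first edge if `p` is the first position.
  slot-top : ∀ {v p} → toℕ v ≡ suc (toℕ (val p)) → ∃ (Slot v p)
  slot-top {p = zero}  eq = zero , record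
    { lower = z≤n ; upper = z≤n ; ascending = λ _ → inj₂ eq ; descending = λ _ → inj₂ eq }
  slot-top {p = suc d} eq = d , record
    { lower = ℕ.n≤1+n _ ; upper = ℕ.≤-refl ; ascending = λ _ → inj₂ eq ; descending = λ _ → inj₂ eq }

  -- A neighbour by position gives the edge leading to it. A neighbour by value has value at least
  -- `v`, so it is the successor of the value at `p`, which forces `v` to be that successor.
  slot : ∀ {v p} → Boundary v p → ∃ (Slot v p)
  slot {v} {suc d} (<v , q , inj₁ (inj₁ p≡1+q) , v≤) = d , slot-left <v (subst (λ x → v Fin.≤ val x)
    (Fin.toℕ-injective (trans (sym (ℕ.suc-injective p≡1+q)) (sym (Fin.toℕ-inject₁ d)))) v≤)
  slot {p = zero} (_ , _ , inj₁ (inj₁ ()) , _)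
  slot (_ , zero , inj₁ (inj₂ ()) , _)
  slot {v} {p} (<v , suc d , inj₁ (inj₂ q≡1+p) , v≤)
    with refl ← Fin.toℕ-injective {i = p} {inject₁ d}
                  (trans (sym (ℕ.suc-injective q≡1+p)) (sym (Fin.toℕ-inject₁ d)))
    = d , slot-right <v v≤
  slot (<v , q , inj₂ (inj₁ πp≡1+πq) , v≤) =
    contradiction (ℕ.<-≤-trans <v v≤) (ℕ.≤⇒≯ (ℕ.≤-trans (ℕ.n≤1+n _) (ℕ.≤-reflexive (sym πp≡1+πq))))
  slot (<v , q , inj₂ (inj₂ πq≡1+πp) , v≤) =
    slot-top (ℕ.≤-antisym (ℕ.≤-trans v≤ (ℕ.≤-reflexive πq≡1+πp)) <v)

  -- With no extremum in between, the values are monotone from the left end of `d` to the right end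
  -- of `d′`. An ascent contradicts the slot of `p`, a descent that of `p′`.
  slots-separated : ∀ {v p p′ d d′} → val p Fin.< v → val p′ Fin.< v → p Fin.< p′ →
    Slot v p d → Slot v p′ d′ → ∃ λ e → d Fin.≤ e × e Fin.< d′ × Extremum e
  slots-separated {v} {p} {p′} {d} {d′} p<v p′<v p<p′ S S′
    with Fin.any? (λ e → (d Fin.≤? e) ×-dec ((e Fin.<? d′) ×-dec localExtremum? π (suc e)))
  ... | yes found = found
  ... | no  none  with Fin.≤-total (val (inject₁ d)) (val (suc d))
  ... | inj₁ up   = contradiction (S.ascending up) λ
    -- As `suc d` is at or before `p′`, the value at `p′` would reach `v`. In the other case both
    -- values would equal v - 1.
    { (inj₁ v≤) → ℕ.<⇒≱ p′<v (ℕ.≤-trans v≤ (along (ℕ.n≤1+n _) (ℕ.≤-trans (s≤s S.lower) p<p′) S′.upper))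
    ; (inj₂ eq) → val-distinct p<p′ (ℕ.≤-antisym (along S.lower (ℕ.<⇒≤ p<p′) S′.upper)
                                        (s≤s⁻¹ (subst (toℕ (val p′) <_) eq p′<v)))
    }
    where
    module S = Slot S
    module S′ = Slot S′
    along : ∀ {x y} → toℕ d ≤ toℕ x → x Fin.≤ y → y Fin.≤ suc d′ → val x Fin.≤ val y
    along = Stretch.stretch {R = λ x y → val x Fin.≤ val y} ℕ.≤-refl ℕ.≤-trans ascent-continues
              (λ d≤e e<d′ ext → none (_ , d≤e , e<d′ , ext)) up
  ... | inj₂ down = contradiction (S′.descending (edge-down d≤d′ ℕ.≤-refl)) λ
    -- The mirror image: `p` is at or before `inject₁ d′`, so its value would reach `v`.
    { (inj₁ v≤) → ℕ.<⇒≱ p<v (ℕ.≤-trans v≤ (along S.lower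
                    (ℕ.≤-trans p≤d′ (ℕ.≤-reflexive (sym (Fin.toℕ-inject₁ d′))))
                    (ℕ.m≤n⇒m≤1+n (ℕ.≤-reflexive (Fin.toℕ-inject₁ d′)))))
    ; (inj₂ eq) → val-distinct p<p′ (ℕ.≤-antisym (s≤s⁻¹ (subst (toℕ (val p) <_) eq p<v))
                                        (along S.lower (ℕ.<⇒≤ p<p′) S′.upper))
    }
    where
    module S = Slot S
    module S′ = Slot S′
    p≤d′ : toℕ p ≤ toℕ d′
    p≤d′ = s≤s⁻¹ (ℕ.≤-trans p<p′ S′.upper)
    d≤d′ : d Fin.≤ d′
    d≤d′ = ℕ.≤-trans S.lower p≤d′
    open Stretch {R = λ x y → val y Fin.≤ val x} ℕ.≤-refl (λ r s → ℕ.≤-trans s r) descent-continues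
           (λ d≤e e<d′ ext → none (_ , d≤e , e<d′ , ext)) down
           renaming (stretch to along; stretch-edge to edge-down)

  -- At `toℕ d` this counts the extrema up to the left end of the edge `d`, without the first
  -- position.
  #extrema : ℕ → ℕ
  #extrema k = length (filter (localExtremum? π) (take k (tabulate suc)))

  #extrema-full : #extrema (suc n) ≡ run π
  #extrema-full = trans
    (cong (length ∘ filter (localExtremum? π))
          (take-all (suc n) (tabulate suc) (ℕ.≤-reflexive (length-tabulate suc))))
    (sym (length-cut (localExtremum? π) (zero ∷ []) (tabulate suc)))

  ∣boundary∣≤run : ∀ v → ∣ boundary v ∣ ≤ run π
  ∣boundary∣≤run v = strictMono⇒∣p∣≤ (boundary v)
    (λ p∈ → #extrema (toℕ (proj₁ (slot (∈⁻ p∈)))))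
    -- The last position lies beyond the left end of every edge, so its extremum is never counted
    -- and the bound is strict.
    (λ p∈ → let d = proj₁ (slot (∈⁻ p∈)) in
      subst (#extrema (toℕ d) <_) #extrema-full
        (length-filter-take-< (localExtremum? π) suc (fromℕ n) last-extremum
          (Fin.≤fromℕ d) (Fin.toℕ<n (fromℕ n))))
    (λ p∈ p′∈ p<p′ →
      let _ , S  = slot (∈⁻ p∈)
          _ , S′ = slot (∈⁻ p′∈)
          e , d≤e , e<d′ , ext = slots-separated (proj₁ (∈⁻ p∈)) (proj₁ (∈⁻ p′∈)) p<p′ S S′
      in length-filter-take-< (localExtremum? π) suc e ext d≤e e<d′)
    where
    ∈⁻ : ∀ {p} → p ∈ boundary v → Boundary v p
    ∈⁻ = ∈-comprehension⁻ (boundary? v)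

lemma4p4 : ∀ (m : ℕ) (π : Permutation′ m) → pw (incidenceGraph π) ≤ run π
-- With at most one position there is no edge to choose; the single bag has width 0, by truncation
-- if `m` is 0.
lemma4p4 zero          π = proj₂ (pw-isPathwidth (incidenceGraph π)) (trivial (incidenceGraph π))
lemma4p4 (suc zero)    π = proj₂ (pw-isPathwidth (incidenceGraph π)) (trivial (incidenceGraph π))
lemma4p4 (suc (suc n)) π = Sweep.pw≤ (incidenceGraph π) π (∣boundary∣≤run π)
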